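{- For all integers $n\geq 1$ and $k\geq 1$ with $k\neq n+1$, $$C(n+1,k)=\sum_{i\geq 1}\binom{k+2i}{k-1}\frac{C(n+1,k+2i)}{n+1-k}+\binom{n+1}{2}\frac{C(n,k)}{n+1-k}.$$
   Context: $C(m,k)$ denotes the unsigned Stirling number of the first kind, i.e. the number of permutations of $[m]=\{1,\dots,m\}$ with exactly $k$ cycles (fixed points count as cycles; $C(m,k)=0$ if $k>m$). -}

module Defs where

open import Data.Fin.Base using (Fin; finToFun)
open import Data.Fin.Properties using (_≟_; all?; any?)
open import Data.Integer.Base as ℤ using (+_)
import Data.Integer.Properties as ℤₚ
open import Data.List.Base using (List; map; filter; length; foldr; iterate; deduplicate; allFin; applyUpTo)
open import Data.List.Membership.Propositional using (_∈_)
open import Data.Nat.Base using (ℕ; suc; _+_; _^_; _<_)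
import Data.Nat.Properties as ℕₚ
open import Data.Product.Base using (∃-syntax; _×_; _,_)
open import Data.Rational.Base as ℚ using (ℚ; 0ℚ)
open import Data.Rational.Literals using (fromℤ)
open import Function.Base using (_∘_)
open import Function.Consequences.Propositional
  using (strictlySurjective⇒surjective; surjective⇒strictlySurjective)
open import Function.Definitions using (Injective; Surjective; Bijective)
open import Level using (0ℓ)
open import Relation.Binary.Core using (Rel)
open import Relation.Binary.Definitions using (Decidable)
open import Relation.Binary.PropositionalEquality using (_≡_; _≢_; sym)
open import Relation.Nullary.Decidable using (Dec; map′; _×-dec_; _→-dec_)

private
  variable
    m : ℕ

  injective? : (σ : Fin m → Fin m) → Dec (Injective _≡_ _≡_ σ)
  injective? σ = map′ (λ inj {i} {j} → inj i j) (λ inj i j → inj {i} {j})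
    (all? λ i → all? λ j → (σ i ≟ σ j) →-dec (i ≟ j))

  surjective? : (σ : Fin m → Fin m) → Dec (Surjective _≡_ _≡_ σ)
  surjective? σ = map′ strictlySurjective⇒surjective surjective⇒strictlySurjective
    (all? λ j → any? λ i → σ i ≟ j)

bijective? : (σ : Fin m → Fin m) → Dec (Bijective _≡_ _≡_ σ)
bijective? σ = injective? σ ×-dec surjective? σ

-- finToFun is a bijection (up to pointwise equality) from Fin (m ^ m) onto
-- Fin m → Fin m, so every permutation of Fin m is listed exactly once.
permutations : (m : ℕ) → List (Fin m → Fin m)
permutations m = filter bijective? (map finToFun (allFin (m ^ m)))

-- A cycle of a permutation of Fin m has at most m elements, so the cycle of i
-- is { i , σ i , … , σ^(m-1) i }.
SameCycle : (Fin m → Fin m) → Rel (Fin m) 0ℓ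
SameCycle {m} σ i j = j ∈ iterate σ i m

sameCycle? : (σ : Fin m → Fin m) → Decidable (SameCycle σ)
sameCycle? {m} σ i j = j ∈? iterate σ i m
  where open import Data.List.Membership.DecPropositional (_≟_ {m}) using (_∈?_)

-- deduplicate keeps exactly one element of each class of SameCycle σ.
cycleCount : (Fin m → Fin m) → ℕ
cycleCount {m} σ = length (deduplicate (sameCycle? σ) (allFin m))

stirling₁ : ℕ → ℕ → ℕ
stirling₁ m k = length (filter (λ σ → cycleCount σ ℕₚ.≟ k) (permutations m))

fromℕ : ℕ → ℚ
fromℕ n = fromℤ (+ n)

-- HasSum₁ f s: the series ∑_{i ≥ 1} f i has only finitely many nonzero terms,
-- and its value is s.  The value of f at 0 is irrelevant.
HasSum₁ : (ℕ → ℚ) → ℚ → Set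
HasSum₁ f s = ∃[ N ]
  (∀ i → N < i → f i ≡ 0ℚ) × foldr ℚ._+_ 0ℚ (applyUpTo (f ∘ suc) N) ≡ s

-- The difference m - k as a rational number, possibly negative.
diff : ℕ → ℕ → ℚ
diff m k = fromℤ (+ m ℤ.- + k)

diff-nonZero : ∀ {m k} → k ≢ m → ℚ.NonZero (diff m k)
diff-nonZero {m} {k} k≢m = ℤ.≢-nonZero
  (λ eq → k≢m (sym (ℤₚ.+-injective (ℤₚ.i-j≡0⇒i≡j (+ m) (+ k) eq))))

{-# OPTIONS --safe #-}
module Submission where

-- The numbers stirling₁ m k are the coefficients of the rising factorial
-- f_m(x) = x (x + 1) ⋯ (x + m - 1), by the recurrence obtained from deleting a point of a
-- permutation.  The coefficient of x^(k-1) in (f_m(x + 1) - f_m(x - 1)) / 2 is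
-- ∑_{i ≥ 0} C(k + 2i, k - 1) stirling₁ m (k + 2i), whose term i = 0 is k stirling₁ m k.
-- Since x f_m(x + 1) = f_{m+1}(x) and f_m(x - 1) = (x - 1) f_{m-1}(x), the theorem is the
-- comparison of coefficients in
--   2 m f_m(x) = x (f_m(x + 1) - f_m(x - 1)) + m (m - 1) f_{m-1}(x),   m = n + 1.

open import Defs
open import Data.Fin.Base as Fin using (Fin; zero; suc; toℕ; lift; punchOut; finToFun; funToFin)
open import Data.Fin.Permutation.Components using (transpose; transpose-inverse)
import Data.Fin.Properties as Finₚ
open import Data.Integer.Base as ℤ using (+_)
import Data.Integer.Properties as ℤₚ
open import Data.List.Base using (List; []; _∷_; _++_; map; filter; length; iterate; deduplicate; allFin; lookup; tabulate; foldr; applyUpTo; cartesianProductWith)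
open import Data.List.Membership.Propositional using (_∈_)
open import Data.List.Membership.Propositional.Properties using (∈-allFin; ∈-lookup)
import Data.List.Membership.Setoid as SetoidMembership
import Data.List.Membership.Setoid.Properties as ∈ₛ
open import Data.List.Properties using (length-map; length-++; filter-++; filter-≐; filter-none)
open import Data.List.Relation.Binary.Subset.Setoid using () renaming (_⊆_ to _[_⊆_])
open import Data.List.Relation.Unary.All as All using (All; []; _∷_)
import Data.List.Relation.Unary.All.Properties as Allₚ
open import Data.List.Relation.Unary.AllPairs using (_∷_)
open import Data.List.Relation.Unary.Any as Any using (here; there; index)
open import Data.List.Relation.Unary.Unique.DecSetoid.Properties using (deduplicate-!)
import Data.List.Relation.Unary.Unique.Propositional.Properties as Uniqueₚ
open import Data.List.Relation.Unary.Unique.Setoid using (Unique)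
import Data.List.Relation.Unary.Unique.Setoid.Properties as Uniqueₛ
open import Data.Nat.Base using (ℕ; zero; suc; _+_; _*_; _∸_; _^_; _≤_; _<_; s≤s; z<s; s<s; parity)
open import Data.Nat.Combinatorics using (_C_; nCk+nC[k+1]≡[n+1]C[k+1]; nC1≡n; nCk≡nC[n∸k])
open import Data.Nat.GeneralisedArithmetic using () renaming (iterate to _^[_]_)
open import Data.Nat.ListAction using (sum)
import Data.Nat.Properties as ℕₚ
open import Data.Nat.Tactic.RingSolver using (solve-∀)
open import Data.Parity.Base using (Parity; 0ℙ; 1ℙ; _⁻¹)
open import Data.Parity.Properties using (suc-homo-⁻¹; ⁻¹-selfInverse)
open import Data.Product.Base using (∃-syntax; ∃₂; _×_; _,_; proj₁; proj₂)
open import Data.Rational.Base as ℚ using (ℚ; 0ℚ; _÷_)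
open import Data.Rational.Literals using (fromℤ)
import Data.Rational.Properties as ℚₚ
open import Data.Sum.Base using (inj₁; inj₂)
open import Function.Base using (_∘_)
open import Function.Consequences.Propositional using (strictlySurjective⇒surjective)
open import Function.Definitions using (Injective; Bijective)
open import Level using (Level; 0ℓ)
open import Relation.Binary.Bundles using (Setoid; DecSetoid)
open import Relation.Binary.Construct.Closure.ReflexiveTransitive using (Star; ε; _◅_; _◅◅_)
open import Relation.Binary.Core using (Rel)
open import Relation.Binary.Definitions using (Decidable)
open import Relation.Binary.PropositionalEquality
open import Relation.Nullary.Decidable using (yes; no; ¬?)
open import Relation.Nullary.Negation using (¬_; contradiction)
import Relation.Unary as U
open ≡-Reasoning

-- The sum in the theorem takes the terms of ∑ C(j, k - 1) `stirling₁` m j with j - (k - 1) odd. The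
-- terms at even and at odd distance add up to a coefficient of f_m(x + 1); their difference is the
-- coefficient of f_m(x - 1). To avoid signs, the two halves are kept as separate natural numbers
-- and every identity is arranged as an equation in ℕ. The divisor n + 1 - k appears only at the
-- end, when the term i = 0 is moved to the other side. On the counting side there are two
-- obstacles: permutations are plain functions, compared pointwise, and `SameCycle` is membership in
-- a list of fixed length. Hence the lists up to a setoid and the detour through reachability in any
-- number of steps.

private
  variable
    ℓ ℓ₁ ℓ₂ ℓ₃ : Level
    A : Set ℓ₁
    B : Set ℓ₂
    m : ℕ

-- Lists without repetition, and iterates of a function

module _ (S : Setoid ℓ₁ ℓ) where
  open Setoid S using (_≈_) renaming (sym to ≈-sym)

  lookup-injective : ∀ {xs} → Unique S xs → ∀ i j → lookup xs i ≈ lookup xs j → i ≡ j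
  lookup-injective (_ ∷ _)     zero    zero    _  = refl
  lookup-injective (x∉xs ∷ _)  zero    (suc j) eq =
    contradiction eq (All.lookup x∉xs (∈-lookup j))
  lookup-injective (x∉xs ∷ _)  (suc i) zero    eq =
    contradiction (≈-sym eq) (All.lookup x∉xs (∈-lookup i))
  lookup-injective (_ ∷ xs!)   (suc i) (suc j) eq = cong suc (lookup-injective xs! i j eq)

  -- Sending each entry of `xs` to its position in `ys` is an injection between index sets, because
  -- no two entries of `xs` are equivalent.
  ⊆⇒length≤ : ∀ {xs ys} → Unique S xs → S [ xs ⊆ ys ] → length xs ≤ length ys
  ⊆⇒length≤ {xs} {ys} xs! xs⊆ys = Finₚ.injective⇒≤ {f = λ i → index (xs⊆ys (∈ₛ.∈-lookup S xs i))}
    λ eq → lookup-injective xs! _ _ (∈ₛ.index-injective S (xs⊆ys (∈ₛ.∈-lookup S xs _)) (xs⊆ys (∈ₛ.∈-lookup S xs _)) eq)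

  ⊆⊇⇒length≡ : ∀ {xs ys} → Unique S xs → Unique S ys → S [ xs ⊆ ys ] → S [ ys ⊆ xs ] → length xs ≡ length ys
  ⊆⊇⇒length≡ xs! ys! xs⊆ys ys⊆xs = ℕₚ.≤-antisym (⊆⇒length≤ xs! xs⊆ys) (⊆⇒length≤ ys! ys⊆xs)

deduplicate-cong : {R Q : Rel A ℓ} (R? : Decidable R) (Q? : Decidable Q) →
                   (∀ {x y} → R x y → Q x y) → (∀ {x y} → Q x y → R x y) →
                   deduplicate R? ≗ deduplicate Q?
deduplicate-cong R? Q? f g []       = refl
deduplicate-cong R? Q? f g (x ∷ xs) = cong (x ∷_) (trans
  (cong (filter (¬? ∘ R? x)) (deduplicate-cong R? Q? f g xs))
  (filter-≐ (¬? ∘ R? x) (¬? ∘ Q? x) ((_∘ g) , (_∘ f)) (deduplicate Q? xs)))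

iterate-cong : {f g : A → A} → f ≗ g → ∀ x n → iterate f x n ≡ iterate g x n
iterate-cong         f≗g x zero    = refl
iterate-cong {f = f} f≗g x (suc n) =
  cong (x ∷_) (trans (cong (λ y → iterate f y n) (f≗g x)) (iterate-cong f≗g _ n))

^[]-+ : (f : A → A) (x : A) (s : ℕ) {t : ℕ} → f ^[ x ] (s + t) ≡ f ^[ f ^[ x ] s ] t
^[]-+ f x zero    = refl
^[]-+ f x (suc s) = ^[]-+ f (f x) s

^[]-injective : {f : A → A} → Injective _≡_ _≡_ f → ∀ n {x y} → f ^[ x ] n ≡ f ^[ y ] n → x ≡ y
^[]-injective inj zero    eq = eq
^[]-injective inj (suc n) eq = inj (^[]-injective inj n eq)

^[]∈iterate : (f : A → A) (x : A) {t n : ℕ} → t < n → f ^[ x ] t ∈ iterate f x n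
^[]∈iterate f x {zero}  z<s       = here refl
^[]∈iterate f x {suc t} (s<s t<n) = there (^[]∈iterate f (f x) t<n)

∈iterate⇒^[] : (f : A → A) (x : A) {y : A} (n : ℕ) → y ∈ iterate f x n → ∃[ t ] t < n × y ≡ f ^[ x ] t
∈iterate⇒^[] f x (suc n) (here eq)  = 0 , z<s , eq
∈iterate⇒^[] f x (suc n) (there y∈) with t , t<n , eq ← ∈iterate⇒^[] f (f x) n y∈ = suc t , s<s t<n , eq

-- Cycles of a self-map of Fin m

Step : (A → A) → Rel A _
Step f x y = f x ≡ y

-- Without a bound on the number of steps, composition is concatenation and paths can be transported
-- one step at a time.
Reach : (A → A) → Rel A _
Reach f = Star (Step f)

^[]-reach : (f : A → A) (x : A) (t : ℕ) → Reach f x (f ^[ x ] t)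
^[]-reach f x zero    = ε
^[]-reach f x (suc t) = refl ◅ ^[]-reach f (f x) t

module _ (σ : Fin m → Fin m) where

  -- Pigeonhole on the m + 1 points x, ..., σ^m x. The period is written `suc p` because it is
  -- positive.
  orbit-repeats : ∀ x → ∃₂ λ s p → s + suc p ≤ m × σ ^[ x ] s ≡ σ ^[ x ] (s + suc p)
  orbit-repeats x
    with i , j , i<j , eq ← Finₚ.pigeonhole ℕₚ.≤-refl (λ (i : Fin (suc m)) → σ ^[ x ] toℕ i)
    with p , refl′ ← ℕₚ.m≤n⇒∃[o]m+o≡n i<j
    = toℕ i , p , subst (_≤ m) j≡ (ℕₚ.≤-pred (Finₚ.toℕ<n j)) , trans eq (cong (σ ^[ x ]_) j≡)
    where j≡ = sym (trans (ℕₚ.+-suc (toℕ i) p) refl′)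

  -- The list ends at σ^(m-1) x, so σ^m x is the first iterate past its end. Going back by one
  -- period identifies it with an entry, which closes the list under `σ`.
  orbit-closed : ∀ x → σ ^[ x ] m ∈ iterate σ x m
  orbit-closed x with s , p , s+p≤m , eq ← orbit-repeats x
    with d , refl ← ℕₚ.m≤n⇒∃[o]m+o≡n s+p≤m = subst (_∈ iterate σ x m) eq′ (^[]∈iterate σ x s+d<m)
    where
    s+d<m : s + d < s + suc p + d
    s+d<m = ℕₚ.+-monoˡ-< d (ℕₚ.m<m+n s z<s)
    eq′ : σ ^[ x ] (s + d) ≡ σ ^[ x ] (s + suc p + d)
    eq′ = trans (^[]-+ σ x s) (trans (cong (σ ^[_] d) eq) (sym (^[]-+ σ x (s + suc p))))

  SameCycle-step : ∀ {x y} → SameCycle σ x y → SameCycle σ x (σ y)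
  SameCycle-step {x} y∈ with t , t<m , refl ← ∈iterate⇒^[] σ x m y∈ =
    subst (_∈ iterate σ x m) (trans (cong (σ ^[ x ]_) (ℕₚ.+-comm 1 t)) (^[]-+ σ x t)) (suc-t∈ (ℕₚ.m≤n⇒m<n∨m≡n t<m))
    where
    suc-t∈ : _ → σ ^[ x ] suc t ∈ iterate σ x m
    suc-t∈ (inj₁ st<m) = ^[]∈iterate σ x st<m
    suc-t∈ (inj₂ st≡m) = subst (λ n → σ ^[ x ] n ∈ iterate σ x m) (sym st≡m) (orbit-closed x)

  SameCycle⇒Reach : ∀ {x y} → SameCycle σ x y → Reach σ x y
  SameCycle⇒Reach {x} y∈ with t , _ , refl ← ∈iterate⇒^[] σ x m y∈ = ^[]-reach σ x t

  SameCycle-◅◅ : ∀ {x y z} → SameCycle σ x y → Reach σ y z → SameCycle σ x z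
  SameCycle-◅◅ xy ε          = xy
  SameCycle-◅◅ xy (refl ◅ r) = SameCycle-◅◅ (SameCycle-step xy) r

SameCycle-refl : (σ : Fin m → Fin m) → ∀ {x} → SameCycle σ x x
SameCycle-refl {suc m} σ = here refl

Reach⇒SameCycle : (σ : Fin m → Fin m) → ∀ {x y} → Reach σ x y → SameCycle σ x y
Reach⇒SameCycle σ = SameCycle-◅◅ σ (SameCycle-refl σ)

module _ {σ : Fin m → Fin m} (inj : Injective _≡_ _≡_ σ) where

  -- By injectivity the first s steps cancel from σ^s x = σ^(s+p+1) x, so the orbit returns to x
  -- itself and a step is undone by going round the cycle.
  Reach-sym : ∀ {x y} → Reach σ x y → Reach σ y x
  Reach-sym ε              = ε
  Reach-sym {x} (refl ◅ r) = Reach-sym r ◅◅ back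
    where
    back : Reach σ (σ x) x
    back with s , p , _ , eq ← orbit-repeats σ x =
      subst (Reach σ (σ x))
        (sym (^[]-injective inj s (trans eq (trans (cong (σ ^[ x ]_) (ℕₚ.+-comm s (suc p))) (^[]-+ σ x (suc p))))))
        (^[]-reach σ (σ x) p)

  cycleDecSetoid : DecSetoid 0ℓ 0ℓ
  cycleDecSetoid = record
    { Carrier          = Fin m
    ; _≈_              = SameCycle σ
    ; isDecEquivalence = record
      { isEquivalence = record
        { refl  = SameCycle-refl σ
        ; sym   = Reach⇒SameCycle σ ∘ Reach-sym ∘ SameCycle⇒Reach σ
        ; trans = λ xy yz → SameCycle-◅◅ σ xy (SameCycle⇒Reach σ yz)
        }
      ; _≟_ = sameCycle? σ
      }
    }

  private
    S = DecSetoid.setoid cycleDecSetoid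
    open SetoidMembership S using () renaming (_∈_ to _∈~_)

  representatives : List (Fin m)
  representatives = deduplicate (sameCycle? σ) (allFin m)

  representatives-! : Unique S representatives
  representatives-! = deduplicate-! cycleDecSetoid (allFin m)

  ∈-representatives : ∀ i → i ∈~ representatives
  ∈-representatives i = ∈ₛ.∈-deduplicate⁺ S (sameCycle? σ)
    (λ z≈y x≈y → Setoid.trans S x≈y (Setoid.sym S z≈y))
    (Any.map (λ { refl → SameCycle-refl σ }) (∈-allFin i))

  -- Any system of representatives gives the count, not only the one that `deduplicate` selects.
  cycleCount-≡ : ∀ {xs} → Unique S xs → (∀ i → i ∈~ xs) → cycleCount σ ≡ length xs
  cycleCount-≡ xs! ∈xs = ⊆⊇⇒length≡ S representatives-! xs! (λ _ → ∈xs _) (λ _ → ∈-representatives _)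

cycleCount-cong : {σ τ : Fin m → Fin m} → σ ≗ τ → cycleCount σ ≡ cycleCount τ
cycleCount-cong {m} {σ} {τ} σ≗τ = cong length (deduplicate-cong (sameCycle? σ) (sameCycle? τ)
  (λ {x} {y} → subst (y ∈_) (iterate-cong σ≗τ x m))
  (λ {x} {y} → subst (y ∈_) (sym (iterate-cong σ≗τ x m))) (allFin m))

-- Extending a permutation of Fin m to Fin (suc m)

-- A permutation of `Fin (suc m)` is determined by the image `i` of zero and by the permutation of
-- the other points that is left when the exchange of zero and `i` is undone.
extend : Fin (suc m) → (Fin m → Fin m) → Fin (suc m) → Fin (suc m)
extend i σ = transpose zero i ∘ lift 1 σ

transpose-injective : ∀ (i j : Fin m) → Injective _≡_ _≡_ (transpose i j)
transpose-injective i j {x} {y} eq =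
  trans (sym (transpose-inverse j i)) (trans (cong (transpose j i) eq) (transpose-inverse j i))

transposeˡ : ∀ (i j : Fin m) → transpose i j i ≡ j
transposeˡ i j with i Finₚ.≟ i
... | yes _   = refl
... | no  i≢i = contradiction refl i≢i

extend-zero : (σ : Fin m → Fin m) → extend zero σ ≗ lift 1 σ
extend-zero σ zero    = refl
extend-zero σ (suc _) = refl

extend-cong : ∀ i {σ τ : Fin m → Fin m} → σ ≗ τ → extend i σ ≗ extend i τ
extend-cong i σ≗τ zero    = refl
extend-cong i σ≗τ (suc x) = cong (transpose zero i ∘ suc) (σ≗τ x)

extend-injective : ∀ {i j} {σ τ : Fin m → Fin m} → extend i σ ≗ extend j τ → i ≡ j × σ ≗ τ
extend-injective {i = i} eq with refl ← eq zero =
  refl , λ x → Finₚ.suc-injective (transpose-injective zero i (eq (suc x)))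

lift-bijective : {σ : Fin m → Fin m} → Bijective _≡_ _≡_ σ → Bijective _≡_ _≡_ (lift 1 σ)
lift-bijective {m} {σ} (inj , surj) = inj⁺ , strictlySurjective⇒surjective surj⁺
  where
  inj⁺ : Injective _≡_ _≡_ (lift 1 σ)
  inj⁺ {zero}  {zero}  _  = refl
  inj⁺ {suc x} {suc y} eq = cong suc (inj (Finₚ.suc-injective eq))
  surj⁺ : ∀ y → ∃[ x ] lift 1 σ x ≡ y
  surj⁺ zero    = zero , refl
  surj⁺ (suc y) with x , eq ← surj y = suc x , cong suc (eq refl)

extend-bijective : ∀ i {σ : Fin m → Fin m} → Bijective _≡_ _≡_ σ → Bijective _≡_ _≡_ (extend i σ)
extend-bijective i {σ} bij with inj , surj ← lift-bijective bij =
  (λ eq → inj (transpose-injective zero i eq)) , strictlySurjective⇒surjective λ y →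
  let x , eq = surj (transpose i zero y) in
  x , trans (cong (transpose zero i) (eq refl)) (transpose-inverse zero i)

-- Undoing the exchange of zero and `τ zero` gives `ρ`, which fixes zero. Being injective, it
-- preserves the nonzero points, and `punchOut` reads off `σ`.
extend-surjective : (τ : Fin (suc m) → Fin (suc m)) → Bijective _≡_ _≡_ τ →
                    ∃₂ λ i σ → Bijective _≡_ _≡_ σ × τ ≗ extend i σ
extend-surjective {m} τ (inj , surj) = τ zero , σ , (σ-inj , strictlySurjective⇒surjective σ-surj) , τ≗
  where
  ρ : Fin (suc m) → Fin (suc m)
  ρ = transpose (τ zero) zero ∘ τ

  ρ-inj : Injective _≡_ _≡_ ρ
  ρ-inj eq = inj (transpose-injective (τ zero) zero eq)

  ρ-zero : ρ zero ≡ zero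
  ρ-zero = transposeˡ (τ zero) zero

  ρ-suc≢0 : ∀ x → zero ≢ ρ (suc x)
  ρ-suc≢0 x eq with () ← ρ-inj (trans ρ-zero eq)

  σ : Fin m → Fin m
  σ x = punchOut (ρ-suc≢0 x)

  suc-σ : ∀ x → suc (σ x) ≡ ρ (suc x)
  suc-σ x = Finₚ.punchIn-punchOut (ρ-suc≢0 x)

  σ-inj : Injective _≡_ _≡_ σ
  σ-inj {x} {y} eq =
    Finₚ.suc-injective (ρ-inj (trans (sym (suc-σ x)) (trans (cong suc eq) (suc-σ y))))

  ρ-surj : ∀ y → ∃[ x ] ρ x ≡ y
  ρ-surj y with x , eq ← surj (transpose zero (τ zero) y) =
    x , trans (cong (transpose (τ zero) zero) (eq refl)) (transpose-inverse (τ zero) zero {y})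

  σ-surj : ∀ y → ∃[ x ] σ x ≡ y
  σ-surj y with ρ-surj (suc y)
  ... | zero  , eq = contradiction (trans (sym ρ-zero) eq) Finₚ.0≢1+n
  ... | suc x , eq = x , Finₚ.suc-injective (trans (suc-σ x) eq)

  τ≗ : τ ≗ extend (τ zero) σ
  τ≗ zero    = refl
  τ≗ (suc x) = sym (trans (cong (transpose zero (τ zero)) (suc-σ x)) (transpose-inverse zero (τ zero)))

-- Cycles of an extended permutation

Reach-cong : {σ τ : A → A} → σ ≗ τ → ∀ {x y} → Reach σ x y → Reach τ x y
Reach-cong σ≗τ ε        = ε
Reach-cong σ≗τ (eq ◅ r) = trans (sym (σ≗τ _)) eq ◅ Reach-cong σ≗τ r

module _ {σ : Fin m → Fin m} where

  lift-suc⁻ : ∀ {x y} → Reach (lift 1 σ) (suc x) (suc y) → Reach σ x y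
  lift-suc⁻ ε          = ε
  lift-suc⁻ (refl ◅ r) = refl ◅ lift-suc⁻ r

  lift-zero-suc : ∀ {x} → ¬ Reach (lift 1 σ) zero (suc x)
  lift-zero-suc (refl ◅ r) = lift-zero-suc r

  lift-suc⁺ : ∀ {x y} → Reach σ x y → Reach (lift 1 σ) (suc x) (suc y)
  lift-suc⁺ ε          = ε
  lift-suc⁺ (refl ◅ r) = refl ◅ lift-suc⁺ r

-- extend (suc j) σ puts zero into the cycle of j, immediately before j.
module _ (j : Fin m) {σ : Fin m → Fin m} where

  private
    τ = extend (suc j) σ

    step⁺ : ∀ x → Reach τ (suc x) (suc (σ x))
    step⁺ x with σ x Finₚ.≟ j in eq
    ... | yes refl = step₀ ◅ refl ◅ ε
      where
      step₀ : τ (suc x) ≡ zero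
      step₀ rewrite eq = refl
    ... | no _  = step₁ ◅ ε
      where
      step₁ : τ (suc x) ≡ suc (σ x)
      step₁ rewrite eq = refl

    -- Contracting zero into `j` turns each step of `τ` into at most one step of `σ`, so paths of
    -- `τ` project to paths of `σ`.
    collapse : Fin (suc m) → Fin m
    collapse zero    = j
    collapse (suc x) = x

    collapse-step : ∀ x → Reach σ (collapse x) (collapse (τ x))
    collapse-step zero    = ε
    collapse-step (suc x) with σ x Finₚ.≟ j
    ... | yes eq = eq ◅ ε
    ... | no  _  = refl ◅ ε

    collapse⁺ : ∀ {x y} → Reach τ x y → Reach σ (collapse x) (collapse y)
    collapse⁺ ε              = ε
    collapse⁺ {x} (refl ◅ r) = collapse-step x ◅◅ collapse⁺ r

  extend-suc⁺ : ∀ {x y} → Reach σ x y → Reach τ (suc x) (suc y)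
  extend-suc⁺ ε              = ε
  extend-suc⁺ {x} (refl ◅ r) = step⁺ x ◅◅ extend-suc⁺ r

  extend-suc⁻ : ∀ {x y} → Reach τ (suc x) (suc y) → Reach σ x y
  extend-suc⁻ = collapse⁺

module _ {σ : Fin m → Fin m} (bij : Bijective _≡_ _≡_ σ) where

  private
    inj = proj₁ bij
    S = DecSetoid.setoid (cycleDecSetoid inj)

  -- Zero is a cycle of its own; the old representatives serve for the other cycles.
  cycleCount-extend-zero : cycleCount (extend zero σ) ≡ suc (cycleCount σ)
  cycleCount-extend-zero = trans (cycleCount-≡ inj′ (Allₚ.map⁺ (All.universal 0≁suc _) ∷ sucs!) ∈reps)
    (cong suc (length-map suc (representatives inj)))
    where
    inj′ = proj₁ (extend-bijective zero bij)
    S′ = DecSetoid.setoid (cycleDecSetoid inj′)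

    toLift : ∀ {x y} → SameCycle (extend zero σ) x y → Reach (lift 1 σ) x y
    toLift = Reach-cong (extend-zero σ) ∘ SameCycle⇒Reach _

    0≁suc : ∀ x → ¬ SameCycle (extend zero σ) zero (suc x)
    0≁suc x = lift-zero-suc ∘ toLift

    sucs! = Uniqueₛ.map⁺ S S′ (Reach⇒SameCycle σ ∘ lift-suc⁻ ∘ toLift) (representatives-! inj)

    ∈reps : ∀ i → SetoidMembership._∈_ S′ i (zero ∷ map suc (representatives inj))
    ∈reps zero    = here (SameCycle-refl (extend zero σ))
    ∈reps (suc x) = there (∈ₛ.∈-map⁺ S S′
      (Reach⇒SameCycle _ ∘ Reach-cong (sym ∘ extend-zero σ) ∘ lift-suc⁺ ∘ SameCycle⇒Reach σ)
      (∈-representatives inj x))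

  -- Zero joins the cycle of `j`, so the old representatives still meet every cycle.
  cycleCount-extend-suc : ∀ j → cycleCount (extend (suc j) σ) ≡ cycleCount σ
  cycleCount-extend-suc j = trans (cycleCount-≡ inj′ sucs! ∈reps) (length-map suc (representatives inj))
    where
    inj′ = proj₁ (extend-bijective (suc j) bij)
    S′ = DecSetoid.setoid (cycleDecSetoid inj′)

    sucs! = Uniqueₛ.map⁺ S S′ (Reach⇒SameCycle σ ∘ extend-suc⁻ j ∘ SameCycle⇒Reach _) (representatives-! inj)

    suc∈reps : ∀ x → SetoidMembership._∈_ S′ (suc x) (map suc (representatives inj))
    suc∈reps x = ∈ₛ.∈-map⁺ S S′ (Reach⇒SameCycle _ ∘ extend-suc⁺ j ∘ SameCycle⇒Reach σ) (∈-representatives inj x)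

    ∈reps : ∀ i → SetoidMembership._∈_ S′ i (map suc (representatives inj))
    ∈reps zero    = ∈ₛ.∈-resp-≈ S′ (Reach⇒SameCycle _ (Reach-sym inj′ (refl ◅ ε))) (suc∈reps j)
    ∈reps (suc x) = suc∈reps x

-- The recurrence for stirling₁

permSetoid : ℕ → Setoid 0ℓ 0ℓ
permSetoid m = Fin m →-setoid Fin m

permutations-! : ∀ m → Unique (permSetoid m) (permutations m)
permutations-! m = Uniqueₛ.filter⁺ (permSetoid m) bijective?
  (Uniqueₛ.map⁺ (setoid _) (permSetoid m) finToFun-injective (Uniqueₚ.allFin⁺ (m ^ m)))
  where
  funToFin-cong : ∀ {m n} {f g : Fin m → Fin n} → f ≗ g → funToFin f ≡ funToFin g
  funToFin-cong {zero}  f≗g = refl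
  funToFin-cong {suc m} f≗g = cong₂ Fin.combine (f≗g zero) (funToFin-cong (f≗g ∘ suc))

  finToFun-injective : ∀ {i j} → finToFun i ≗ finToFun j → i ≡ j
  finToFun-injective {i} {j} eq =
    trans (sym (Finₚ.funToFin-finToFin {m} {m} i)) (trans (funToFin-cong eq) (Finₚ.funToFin-finToFin {m} {m} j))

Bijective-resp-≗ : {σ τ : Fin m → Fin m} → σ ≗ τ → Bijective _≡_ _≡_ σ → Bijective _≡_ _≡_ τ
Bijective-resp-≗ σ≗τ (inj , surj) =
  (λ eq → inj (trans (σ≗τ _) (trans eq (sym (σ≗τ _))))) ,
  λ y → proj₁ (surj y) , λ { refl → trans (sym (σ≗τ _)) (proj₂ (surj y) refl) }

module _ {m : ℕ} where
  open SetoidMembership (permSetoid m) using () renaming (_∈_ to _∈≗_)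

  ∈-permutations⁺ : ∀ {σ} → Bijective _≡_ _≡_ σ → σ ∈≗ permutations m
  ∈-permutations⁺ {σ} bij = ∈ₛ.∈-filter⁺ (permSetoid m) bijective? Bijective-resp-≗
    (∈ₛ.∈-resp-≈ (permSetoid m) (Finₚ.finToFun-funToFin σ)
      (∈ₛ.∈-map⁺ (setoid _) (permSetoid m) (λ { refl _ → refl }) (∈-allFin (funToFin σ))))
    bij

  ∈-permutations⁻ : ∀ {σ} → σ ∈≗ permutations m → Bijective _≡_ _≡_ σ
  ∈-permutations⁻ σ∈ = proj₂ (∈ₛ.∈-filter⁻ (permSetoid m) bijective? Bijective-resp-≗ {xs = map finToFun (allFin (m ^ m))} σ∈)

permutations-bijective : ∀ m → All (Bijective _≡_ _≡_) (permutations m)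
permutations-bijective m = Allₚ.all-filter bijective? (map finToFun (allFin (m ^ m)))

hasCycles? : ∀ k → U.Decidable (λ (σ : Fin m → Fin m) → cycleCount σ ≡ k)
hasCycles? k σ = cycleCount σ ℕₚ.≟ k

extensions : ∀ m → List (Fin (suc m) → Fin (suc m))
extensions m = cartesianProductWith extend (allFin (suc m)) (permutations m)

-- `extensions` groups the permutations by the image of zero. It has the same members as
-- `permutations` up to pointwise equality, and neither list repeats one.
stirling₁-extensions : ∀ m k → stirling₁ (suc m) k ≡ length (filter (hasCycles? k) (extensions m))
stirling₁-extensions m k = ⊆⊇⇒length≡ S
  (Uniqueₛ.filter⁺ S (hasCycles? k) (permutations-! (suc m)))
  (Uniqueₛ.filter⁺ S (hasCycles? k)
    (Uniqueₛ.cartesianProductWith⁺ (setoid _) (permSetoid m) S extend extend-injective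
      (Uniqueₚ.allFin⁺ (suc m)) (permutations-! m)))
  (filter-mono perm⇒ext)
  (filter-mono ext⇒perm)
  where
  S = permSetoid (suc m)
  open SetoidMembership S using () renaming (_∈_ to _∈≗_)

  cycles-resp : ∀ {σ τ} → σ ≗ τ → cycleCount σ ≡ k → cycleCount τ ≡ k
  cycles-resp σ≗τ eq = trans (sym (cycleCount-cong σ≗τ)) eq

  filter-mono : ∀ {xs ys} → S [ xs ⊆ ys ] → S [ filter (hasCycles? k) xs ⊆ filter (hasCycles? k) ys ]
  filter-mono {xs} xs⊆ys x∈ with x∈xs , px ← ∈ₛ.∈-filter⁻ S (hasCycles? k) cycles-resp {xs = xs} x∈ =
    ∈ₛ.∈-filter⁺ S (hasCycles? k) cycles-resp (xs⊆ys x∈xs) px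

  perm⇒ext : ∀ {τ} → τ ∈≗ permutations (suc m) → τ ∈≗ extensions m
  perm⇒ext {τ} τ∈ with i , σ , bij , τ≗ ← extend-surjective τ (∈-permutations⁻ τ∈) =
    ∈ₛ.∈-resp-≈ S (sym ∘ τ≗) (∈ₛ.∈-cartesianProductWith⁺ (setoid _) (permSetoid m) S
      (λ { {i} refl σ≗ → extend-cong i σ≗ }) (∈-allFin i) (∈-permutations⁺ bij))

  ext⇒perm : ∀ {τ} → τ ∈≗ extensions m → τ ∈≗ permutations (suc m)
  ext⇒perm τ∈ with i , σ , _ , σ∈ , τ≗ ← ∈ₛ.∈-cartesianProductWith⁻ (setoid _) (permSetoid m) S extend (allFin (suc m)) (permutations m) τ∈ =
    ∈-permutations⁺ (Bijective-resp-≗ (sym ∘ τ≗) (extend-bijective i (∈-permutations⁻ σ∈)))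

length-filter-map : {P : A → Set ℓ} {Q : B → Set ℓ₃} (P? : U.Decidable P) (Q? : U.Decidable Q)
                    (f : A → B) {xs : List A} →
                    All (λ x → (P x → Q (f x)) × (Q (f x) → P x)) xs →
                    length (filter Q? (map f xs)) ≡ length (filter P? xs)
length-filter-map P? Q? f []                          = refl
length-filter-map P? Q? f (_∷_ {x} (to , from) iffs) with P? x | Q? (f x)
... | yes _ | yes _  = cong suc (length-filter-map P? Q? f iffs)
... | no _  | no _   = length-filter-map P? Q? f iffs
... | yes p | no ¬q  = contradiction (to p) ¬q
... | no ¬p | yes q  = contradiction (from q) ¬p

-- Fixing zero adds one cycle; each of the m ways to insert zero into a cycle leaves their number
-- unchanged.
stirling₁-suc-suc : ∀ m k → stirling₁ (suc m) (suc k) ≡ stirling₁ m k + m * stirling₁ m (suc k)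
stirling₁-suc-suc m k = begin
  stirling₁ (suc m) (suc k)
    ≡⟨ stirling₁-extensions m (suc k) ⟩
  count (extensions m)
    ≡⟨ count-++ (map (extend zero) (permutations m)) _ ⟩
  count (map (extend zero) (permutations m)) + count (cartesianProductWith extend (tabulate suc) (permutations m))
    ≡⟨ cong₂ _+_ fixed (inserted (λ i → i)) ⟩
  stirling₁ m k + m * stirling₁ m (suc k) ∎
  where
  count : List (Fin (suc m) → Fin (suc m)) → ℕ
  count = length ∘ filter (hasCycles? (suc k))

  count-++ : ∀ xs ys → count (xs ++ ys) ≡ count xs + count ys
  count-++ xs ys = trans (cong length (filter-++ (hasCycles? (suc k)) xs ys)) (length-++ (filter (hasCycles? (suc k)) xs))

  fixed : count (map (extend zero) (permutations m)) ≡ stirling₁ m k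
  fixed = length-filter-map (hasCycles? k) (hasCycles? (suc k)) (extend zero)
    (All.map (λ bij → (λ eq → trans (cycleCount-extend-zero bij) (cong suc eq)) ,
                      (λ eq → ℕₚ.suc-injective (trans (sym (cycleCount-extend-zero bij)) eq)))
      (permutations-bijective m))

  insertedAt : ∀ j → count (map (extend (suc j)) (permutations m)) ≡ stirling₁ m (suc k)
  insertedAt j = length-filter-map (hasCycles? (suc k)) (hasCycles? (suc k)) (extend (suc j))
    (All.map (λ bij → trans (cycleCount-extend-suc bij j) , trans (sym (cycleCount-extend-suc bij j)))
      (permutations-bijective m))

  -- Stated for any `f`, so that the induction can peel off the blocks of `tabulate` one by one.
  inserted : ∀ {n} (f : Fin n → Fin m) →
             count (cartesianProductWith extend (tabulate (suc ∘ f)) (permutations m)) ≡ n * stirling₁ m (suc k)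
  inserted {zero}  f = refl
  inserted {suc n} f = trans (count-++ (map (extend (suc (f zero))) (permutations m)) _)
    (cong₂ _+_ (insertedAt (f zero)) (inserted (f ∘ suc)))

-- `deduplicate` keeps the first point, so `cycleCount` on `Fin (suc m)` reduces to a successor.
stirling₁-suc-zero : ∀ m → stirling₁ (suc m) 0 ≡ 0
stirling₁-suc-zero m = cong length (filter-none (hasCycles? 0) (All.universal (λ _ ()) (permutations (suc m))))

-- Moments of the Stirling numbers

∑ : (ℕ → ℕ) → ℕ → ℕ
∑ f n = sum (applyUpTo f n)

∑-cong : ∀ {f g} → f ≗ g → ∀ n → ∑ f n ≡ ∑ g n
∑-cong f≗g zero    = refl
∑-cong f≗g (suc n) = cong₂ _+_ (f≗g 0) (∑-cong (f≗g ∘ suc) n)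

∑-zero : ∀ {f} → (∀ i → f i ≡ 0) → ∀ n → ∑ f n ≡ 0
∑-zero f≡0 zero    = refl
∑-zero f≡0 (suc n) = cong₂ _+_ (f≡0 0) (∑-zero (f≡0 ∘ suc) n)

∑-linear : ∀ f g c n → ∑ (λ i → f i + c * g i) n ≡ ∑ f n + c * ∑ g n
∑-linear f g c zero    = sym (ℕₚ.*-zeroʳ c)
∑-linear f g c (suc n) = trans (cong (_+_ (f 0 + c * g 0)) (∑-linear (f ∘ suc) (g ∘ suc) c n))
  (rearrange (f 0) (g 0) c (∑ (f ∘ suc) n) (∑ (g ∘ suc) n))
  where
  rearrange : ∀ a b c s t → a + c * b + (s + c * t) ≡ a + s + c * (b + t)
  rearrange = solve-∀

∑-drop : ∀ {f} k → (∀ {i} → i < k → f i ≡ 0) → ∀ n → ∑ f (k + n) ≡ ∑ (λ i → f (k + i)) n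
∑-drop zero    f≡0 n = refl
∑-drop (suc k) f≡0 n = cong₂ _+_ (f≡0 z<s) (∑-drop k (f≡0 ∘ s<s) n)

∑-odd : ∀ {f} → (∀ i → f (2 * i) ≡ 0) → ∀ n → ∑ f (2 * n) ≡ ∑ (λ i → f (suc (2 * i))) n
∑-odd f≡0 zero = refl
∑-odd {f} f≡0 (suc n) = begin
  ∑ f (2 * suc n)
    ≡⟨ cong (∑ f) (ℕₚ.*-suc 2 n) ⟩
  f 0 + (f 1 + ∑ (λ i → f (2 + i)) (2 * n))
    ≡⟨ cong₂ (λ a b → a + (f 1 + b)) (f≡0 0) (∑-odd (λ i → trans (cong f (sym (ℕₚ.*-suc 2 i))) (f≡0 (suc i))) n) ⟩
  f 1 + ∑ (λ i → f (3 + 2 * i)) n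
    ≡⟨ cong (_+_ (f 1)) (∑-cong (λ i → cong (f ∘ suc) (sym (ℕₚ.*-suc 2 i))) n) ⟩
  f 1 + ∑ (λ i → f (suc (2 * suc i))) n ∎

-- Multiplication by x of the polynomial with coefficients c.
shift : (ℕ → ℕ) → ℕ → ℕ
shift c zero    = 0
shift c (suc k) = c k

-- Coefficient form of f_(m+1)(x) = (x + m) f_m(x), with k = 0 included.
stirling₁-suc : ∀ m k → stirling₁ (suc m) k ≡ shift (stirling₁ m) k + m * stirling₁ m k
stirling₁-suc zero    zero    = refl
stirling₁-suc (suc m) zero    = trans (stirling₁-suc-zero (suc m))
  (sym (trans (cong (suc m *_) (stirling₁-suc-zero m)) (ℕₚ.*-zeroʳ m)))
stirling₁-suc m       (suc k) = stirling₁-suc-suc m k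

stirling₁-vanish : ∀ {m k} → m < k → stirling₁ m k ≡ 0
stirling₁-vanish {zero}  {suc k} _         = refl
stirling₁-vanish {suc m} {suc k} (s<s m<k) = trans (stirling₁-suc-suc m k)
  (cong₂ _+_ (stirling₁-vanish m<k) (trans (cong (m *_) (stirling₁-vanish (ℕₚ.m<n⇒m<1+n m<k))) (ℕₚ.*-zeroʳ m)))

-- moment m w is ∑ⱼ w j * stirling₁ m j (see moment-∑).  Iterating the Stirling recurrence
-- defines it without a summation bound, so that linearity and induction on m need no
-- bookkeeping at the ends of the range.
moment : ℕ → (ℕ → ℕ) → ℕ
moment zero    w = w 0
moment (suc m) w = moment m (w ∘ suc) + m * moment m w

moment-cong : ∀ m {v w} → v ≗ w → moment m v ≡ moment m w
moment-cong zero    v≗w = v≗w 0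
moment-cong (suc m) v≗w = cong₂ (λ a b → a + m * b) (moment-cong m (v≗w ∘ suc)) (moment-cong m v≗w)

moment-+ : ∀ m v w → moment m (λ j → v j + w j) ≡ moment m v + moment m w
moment-+ zero    v w = refl
moment-+ (suc m) v w = trans
  (cong₂ (λ a b → a + m * b) (moment-+ m (v ∘ suc) (w ∘ suc)) (moment-+ m v w))
  (rearrange m (moment m (v ∘ suc)) (moment m (w ∘ suc)) (moment m v) (moment m w))
  where
  rearrange : ∀ m a b c d → a + b + m * (c + d) ≡ a + m * c + (b + m * d)
  rearrange = solve-∀

-- The freedom in `n` lets `odd-moment-∑` choose a range that suits its weights.
moment-∑ : ∀ m w {n} → m < n → moment m w ≡ ∑ (λ j → w j * stirling₁ m j) n
moment-∑ zero    w {suc n} _ = sym (trans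
  (cong₂ _+_ (ℕₚ.*-identityʳ (w 0)) (∑-zero (λ i → ℕₚ.*-zeroʳ (w (suc i))) n))
  (ℕₚ.+-identityʳ (w 0)))
moment-∑ (suc m) w {suc n} (s<s m<n) = sym (begin
  ∑ (λ j → w j * stirling₁ (suc m) j) (suc n)
    ≡⟨ ∑-cong (λ j → trans (cong (w j *_) (stirling₁-suc m j)) (distrib (w j) m (shift (stirling₁ m) j) (stirling₁ m j))) (suc n) ⟩
  ∑ (λ j → w j * shift (stirling₁ m) j + m * (w j * stirling₁ m j)) (suc n)
    ≡⟨ ∑-linear (λ j → w j * shift (stirling₁ m) j) (λ j → w j * stirling₁ m j) m (suc n) ⟩
  w 0 * 0 + ∑ (λ j → w (suc j) * stirling₁ m j) n + m * ∑ (λ j → w j * stirling₁ m j) (suc n)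
    ≡⟨ cong (λ z → z + ∑ (λ j → w (suc j) * stirling₁ m j) n + m * ∑ (λ j → w j * stirling₁ m j) (suc n)) (ℕₚ.*-zeroʳ (w 0)) ⟩
  ∑ (λ j → w (suc j) * stirling₁ m j) n + m * ∑ (λ j → w j * stirling₁ m j) (suc n)
    ≡⟨ cong₂ (λ a b → a + m * b) (moment-∑ m (w ∘ suc) m<n) (moment-∑ m w (ℕₚ.m<n⇒m<1+n m<n)) ⟨
  moment (suc m) w ∎)
  where
  distrib : ∀ w m a b → w * (a + m * b) ≡ w * a + m * (w * b)
  distrib = solve-∀

-- Coefficient form of x f_m(x + 1) = f_(m+1)(x). In the induction Pascal's rule contributes one
-- more copy of the second term, so that m becomes m + 1, as the factor x + 1 + m demands.
moment-C : ∀ m k → moment m (_C k) ≡ stirling₁ (suc m) (suc k)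
moment-C zero    zero    = refl
moment-C zero    (suc k) = refl
moment-C (suc m) zero    = begin
  moment m (λ j → suc j C 0) + m * moment m (_C 0)
    ≡⟨ cong (_+ m * moment m (_C 0)) (moment-cong m (λ _ → refl)) ⟩
  suc m * moment m (_C 0)
    ≡⟨ cong (suc m *_) (moment-C m 0) ⟩
  suc m * stirling₁ (suc m) 1
    ≡⟨ cong (_+ suc m * stirling₁ (suc m) 1) (stirling₁-suc-zero m) ⟨
  stirling₁ (suc m) 0 + suc m * stirling₁ (suc m) 1
    ≡⟨ stirling₁-suc-suc (suc m) 0 ⟨
  stirling₁ (2 + m) 1 ∎
moment-C (suc m) (suc k) = begin
  moment m (λ j → suc j C suc k) + m * moment m (_C suc k)
    ≡⟨ cong (_+ m * moment m (_C suc k)) (moment-cong m (λ j → nCk+nC[k+1]≡[n+1]C[k+1] j k)) ⟨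
  moment m (λ j → j C k + j C suc k) + m * moment m (_C suc k)
    ≡⟨ cong (_+ m * moment m (_C suc k)) (moment-+ m (_C k) (_C suc k)) ⟩
  moment m (_C k) + moment m (_C suc k) + m * moment m (_C suc k)
    ≡⟨ ℕₚ.+-assoc (moment m (_C k)) (moment m (_C suc k)) _ ⟩
  moment m (_C k) + suc m * moment m (_C suc k)
    ≡⟨ cong₂ (λ a b → a + suc m * b) (moment-C m k) (moment-C m (suc k)) ⟩
  stirling₁ (suc m) (suc k) + suc m * stirling₁ (suc m) (2 + k)
    ≡⟨ stirling₁-suc-suc (suc m) (suc k) ⟨
  stirling₁ (2 + m) (2 + k) ∎

-- Binomial coefficients split by parity

-- parityC p k j is j C k if j ∸ k has parity p, and 0 otherwise.
parityC : Parity → ℕ → ℕ → ℕ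
parityC 0ℙ zero    zero    = 1
parityC 1ℙ zero    zero    = 0
parityC p  (suc k) zero    = 0
parityC p  zero    (suc j) = parityC (p ⁻¹) zero j
parityC p  (suc k) (suc j) = parityC p k j + parityC (p ⁻¹) (suc k) j

parityC-sum : ∀ k j → parityC 0ℙ k j + parityC 1ℙ k j ≡ j C k
parityC-sum zero    zero    = refl
parityC-sum (suc k) zero    = refl
parityC-sum zero    (suc j) = trans (ℕₚ.+-comm (parityC 1ℙ 0 j) _) (parityC-sum zero j)
parityC-sum (suc k) (suc j) = begin
  a + d + (b + c)       ≡⟨ rearrange a b c d ⟩
  a + b + (c + d)       ≡⟨ cong₂ _+_ (parityC-sum k j) (parityC-sum (suc k) j) ⟩
  j C k + j C suc k     ≡⟨ nCk+nC[k+1]≡[n+1]C[k+1] j k ⟩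
  suc j C suc k         ∎
  where
  a = parityC 0ℙ k j
  b = parityC 1ℙ k j
  c = parityC 0ℙ (suc k) j
  d = parityC 1ℙ (suc k) j
  rearrange : ∀ a b c d → a + d + (b + c) ≡ a + b + (c + d)
  rearrange = solve-∀

parityC-< : ∀ p {k j} → j < k → parityC p k j ≡ 0
parityC-< 0ℙ {suc k} {zero}  _         = refl
parityC-< 1ℙ {suc k} {zero}  _         = refl
parityC-< 0ℙ {suc k} {suc j} (s<s j<k) = cong₂ _+_ (parityC-< 0ℙ j<k) (parityC-< 1ℙ (ℕₚ.m<n⇒m<1+n j<k))
parityC-< 1ℙ {suc k} {suc j} (s<s j<k) = cong₂ _+_ (parityC-< 1ℙ j<k) (parityC-< 0ℙ (ℕₚ.m<n⇒m<1+n j<k))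

parity-suc : ∀ d → parity d ⁻¹ ≡ parity (suc d)
parity-suc d = ⁻¹-selfInverse (suc-homo-⁻¹ d)

-- `parityC` matches on the parity first, so its clauses compute only once `p` is a constructor;
-- `parityC-suc` is there for the same reason.
parityC-zero : ∀ p j → parityC p zero (suc j) ≡ parityC (p ⁻¹) zero j
parityC-zero 0ℙ j = refl
parityC-zero 1ℙ j = refl

parityC-suc : ∀ p k j → parityC p (suc k) (suc j) ≡ parityC p k j + parityC (p ⁻¹) (suc k) j
parityC-suc 0ℙ k j = refl
parityC-suc 1ℙ k j = refl

-- The parity of d + 1 is the wrong one for the distance d. Both terms of Pascal's rule inherit the
-- mismatch, except that at d = 0 the second vanishes because its lower index is too large.
parityC-opposite : ∀ k d → parityC (parity (suc d)) k (k + d) ≡ 0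
parityC-opposite zero    zero    = refl
parityC-opposite zero    (suc d) = trans (parityC-zero (parity d) d)
  (trans (cong (λ p → parityC p 0 d) (parity-suc d)) (parityC-opposite zero d))
parityC-opposite (suc k) zero    = cong₂ _+_ (parityC-opposite k zero)
  (parityC-< 0ℙ (s≤s (ℕₚ.≤-reflexive (ℕₚ.+-identityʳ k))))
parityC-opposite (suc k) (suc d) = trans (parityC-suc (parity d) k (k + suc d))
  (cong₂ _+_ (parityC-opposite k (suc d))
    (trans (cong₂ (λ p j → parityC p (suc k) j) (parity-suc d) (ℕₚ.+-suc k d)) (parityC-opposite (suc k) d)))

parity-2* : ∀ i → parity (2 * i) ≡ 0ℙ
parity-2* zero    = refl
parity-2* (suc i) = trans (cong parity (ℕₚ.*-suc 2 i)) (parity-2* i)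

parityC-even : ∀ k i → parityC 1ℙ k (k + 2 * i) ≡ 0
parityC-even k i = trans
  (cong (λ p → parityC p k (k + 2 * i)) (trans (cong _⁻¹ (sym (parity-2* i))) (parity-suc (2 * i))))
  (parityC-opposite k (2 * i))

parityC-odd : ∀ k i → parityC 1ℙ k (k + suc (2 * i)) ≡ (k + suc (2 * i)) C k
parityC-odd k i = trans (cong (_+ parityC 1ℙ k j) (sym even≡0)) (parityC-sum k j)
  where
  j = k + suc (2 * i)
  even≡0 : parityC 0ℙ k j ≡ 0
  even≡0 = trans (cong (λ p → parityC p k j) (sym (parity-2* i))) (parityC-opposite k (suc (2 * i)))

moment-parity-sum : ∀ m k → moment m (parityC 0ℙ k) + moment m (parityC 1ℙ k) ≡ stirling₁ (suc m) (suc k)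
moment-parity-sum m k = begin
  moment m (parityC 0ℙ k) + moment m (parityC 1ℙ k)  ≡⟨ moment-+ m (parityC 0ℙ k) (parityC 1ℙ k) ⟨
  moment m (λ j → parityC 0ℙ k j + parityC 1ℙ k j)   ≡⟨ moment-cong m (parityC-sum k) ⟩
  moment m (_C k)                                    ≡⟨ moment-C m k ⟩
  stirling₁ (suc m) (suc k)                          ∎

moment-parity-zero : ∀ p m → moment (suc m) (parityC p 0) ≡ moment m (parityC (p ⁻¹) 0) + m * moment m (parityC p 0)
moment-parity-zero p m = cong (_+ m * moment m (parityC p 0)) (moment-cong m (parityC-zero p))

moment-parity-suc : ∀ p m k → moment (suc m) (parityC p (suc k)) ≡
  moment m (parityC p k) + moment m (parityC (p ⁻¹) (suc k)) + m * moment m (parityC p (suc k))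
moment-parity-suc p m k = cong (_+ m * moment m (parityC p (suc k)))
  (trans (moment-cong m (parityC-suc p k)) (moment-+ m (parityC p k) (parityC (p ⁻¹) (suc k))))

-- The identity f_{m+1}(x - 1) = (x - 1) f_m(x) for rising factorials, in coefficients and
-- with both sides moved so that no signs occur.
moment-parity-diff : ∀ m k → moment (suc m) (parityC 0ℙ k) + stirling₁ m k ≡
                             moment (suc m) (parityC 1ℙ k) + shift (stirling₁ m) k
moment-parity-diff zero    zero          = refl
moment-parity-diff zero    (suc zero)    = refl
moment-parity-diff zero    (suc (suc k)) = refl
moment-parity-diff (suc m) zero          = begin
  moment (2 + m) (parityC 0ℙ 0) + stirling₁ (suc m) 0
    ≡⟨ cong₂ _+_ (moment-parity-zero 0ℙ (suc m)) (stirling₁-suc m 0) ⟩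
  o + suc m * e + m * c
    ≡⟨ pull o e m c ⟩
  o + e + m * (e + c)
    ≡⟨ cong (λ z → o + e + m * z) (moment-parity-diff m 0) ⟩
  o + e + m * (o + 0)
    ≡⟨ push o e m ⟩
  e + suc m * o + 0
    ≡⟨ cong (_+ 0) (moment-parity-zero 1ℙ (suc m)) ⟨
  moment (2 + m) (parityC 1ℙ 0) + 0 ∎
  where
  e = moment (suc m) (parityC 0ℙ 0)
  o = moment (suc m) (parityC 1ℙ 0)
  c = stirling₁ m 0
  pull : ∀ o e m c → o + suc m * e + m * c ≡ o + e + m * (e + c)
  pull = solve-∀
  push : ∀ o e m → o + e + m * (o + 0) ≡ e + suc m * o + 0
  push = solve-∀
moment-parity-diff (suc m) (suc k)       = begin
  moment (2 + m) (parityC 0ℙ (suc k)) + stirling₁ (suc m) (suc k)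
    ≡⟨ cong₂ _+_ (moment-parity-suc 0ℙ (suc m) k) (stirling₁-suc m (suc k)) ⟩
  e + o′ + suc m * e′ + (c + m * c′)
    -- Both sides of the polynomial identity gain the factor x + m: its x calls for the induction
    -- hypothesis at `k`, its m for m copies of the one at `suc k`. The spare `e′` and `o′` occur on
    -- both sides.
    ≡⟨ pull e o′ m e′ c c′ ⟩
  (e + c) + o′ + e′ + m * (e′ + c′)
    ≡⟨ cong₂ (λ y z → y + o′ + e′ + m * z) (moment-parity-diff m k) (moment-parity-diff m (suc k)) ⟩
  (o + b) + o′ + e′ + m * (o′ + c)
    ≡⟨ push o o′ m e′ b c ⟩
  o + e′ + suc m * o′ + (b + m * c)
    ≡⟨ cong₂ _+_ (moment-parity-suc 1ℙ (suc m) k) (stirling₁-suc m k) ⟨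
  moment (2 + m) (parityC 1ℙ (suc k)) + stirling₁ (suc m) k ∎
  where
  e  = moment (suc m) (parityC 0ℙ k)
  o  = moment (suc m) (parityC 1ℙ k)
  e′ = moment (suc m) (parityC 0ℙ (suc k))
  o′ = moment (suc m) (parityC 1ℙ (suc k))
  b  = shift (stirling₁ m) k
  c  = stirling₁ m k
  c′ = stirling₁ m (suc k)
  pull : ∀ e o′ m e′ c c′ → e + o′ + suc m * e′ + (c + m * c′) ≡ (e + c) + o′ + e′ + m * (e′ + c′)
  pull = solve-∀
  push : ∀ o o′ m e′ b c → (o + b) + o′ + e′ + m * (o′ + c) ≡ o + e′ + suc m * o′ + (b + m * c)
  push = solve-∀

-- The odd part and its expansion as a sum

2*[1+n]C2≡[1+n]*n : ∀ n → 2 * (suc n C 2) ≡ suc n * n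
2*[1+n]C2≡[1+n]*n zero    = refl
2*[1+n]C2≡[1+n]*n (suc n) = begin
  2 * (suc (suc n) C 2)       ≡⟨ cong (2 *_) (nCk+nC[k+1]≡[n+1]C[k+1] (suc n) 1) ⟨
  2 * (suc n C 1 + suc n C 2) ≡⟨ cong (λ z → 2 * (z + suc n C 2)) (nC1≡n (suc n)) ⟩
  2 * (suc n + suc n C 2)     ≡⟨ ℕₚ.*-distribˡ-+ 2 (suc n) (suc n C 2) ⟩
  2 * suc n + 2 * (suc n C 2) ≡⟨ cong (_+_ (2 * suc n)) (2*[1+n]C2≡[1+n]*n n) ⟩
  2 * suc n + suc n * n       ≡⟨ rearrange n ⟩
  (2 + n) * suc n             ∎
  where
  rearrange : ∀ n → 2 * suc n + suc n * n ≡ (2 + n) * suc n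
  rearrange = solve-∀

-- The odd part is isolated by subtracting the coefficient formula of f(x - 1) from that of
-- f(x + 1), which leaves it doubled.
odd-moment : ∀ n k → suc n * stirling₁ (suc n) (suc k) ≡
                     moment (suc n) (parityC 1ℙ k) + (suc n C 2) * stirling₁ n (suc k)
odd-moment n k = ℕₚ.*-cancelˡ-≡ _ _ 2 (ℕₚ.+-cancelʳ-≡ b _ _ (sym (begin
  -- The added `b` completes `o + b`, which can be exchanged for `e + c`; this produces `e + o`, the
  -- full coefficient of f(x + 1).
  2 * (o + q * c′) + b          ≡⟨ expand o q c′ b ⟩
  o + 2 * q * c′ + (o + b)      ≡⟨ cong₂ (λ y z → o + y * c′ + z) (2*[1+n]C2≡[1+n]*n n) (sym (moment-parity-diff n k)) ⟩
  o + suc n * n * c′ + (e + c)  ≡⟨ regroup o (suc n * n * c′) e c ⟩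
  e + o + suc n * n * c′ + c    ≡⟨ cong (λ z → z + suc n * n * c′ + c) e+o ⟩
  b + n * c + suc n * (c + n * c′) + suc n * n * c′ + c
                                ≡⟨ collect n b c c′ ⟩
  2 * (suc n * (c + n * c′)) + b ≡⟨ cong (λ z → 2 * (suc n * z) + b) (stirling₁-suc-suc n k) ⟨
  2 * (suc n * stirling₁ (suc n) (suc k)) + b ∎)))
  where
  e  = moment (suc n) (parityC 0ℙ k)
  o  = moment (suc n) (parityC 1ℙ k)
  q  = suc n C 2
  b  = shift (stirling₁ n) k
  c  = stirling₁ n k
  c′ = stirling₁ n (suc k)
  -- Everything is reduced to row n, so that `collect` is a polynomial identity in n, `b`, `c` and
  -- `c′`.
  e+o : e + o ≡ b + n * c + suc n * (c + n * c′)
  e+o = begin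
    e + o                      ≡⟨ moment-parity-sum (suc n) k ⟩
    stirling₁ (2 + n) (suc k)  ≡⟨ stirling₁-suc-suc (suc n) k ⟩
    stirling₁ (suc n) k + suc n * stirling₁ (suc n) (suc k)
      ≡⟨ cong₂ (λ y z → y + suc n * z) (stirling₁-suc n k) (stirling₁-suc-suc n k) ⟩
    b + n * c + suc n * (c + n * c′) ∎
  expand : ∀ o q c′ b → 2 * (o + q * c′) + b ≡ o + 2 * q * c′ + (o + b)
  expand = solve-∀
  regroup : ∀ o x e c → o + x + (e + c) ≡ e + o + x + c
  regroup = solve-∀
  collect : ∀ n b c c′ → b + n * c + suc n * (c + n * c′) + suc n * n * c′ + c ≡ 2 * (suc n * (c + n * c′)) + b
  collect = solve-∀

[1+n]Cn≡1+n : ∀ n → suc n C n ≡ suc n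
[1+n]Cn≡1+n n = trans (nCk≡nC[n∸k] (ℕₚ.n≤1+n n)) (trans (cong (suc n C_) (ℕₚ.m+n∸n≡m 1 n)) (nC1≡n (suc n)))

odd-moment-∑ : ∀ m k → moment m (parityC 1ℙ k) ≡
  suc k * stirling₁ m (suc k) + ∑ (λ i → ((suc k + 2 * suc i) C k) * stirling₁ m (suc k + 2 * suc i)) m
odd-moment-∑ m k = begin
  moment m (parityC 1ℙ k)
    ≡⟨ moment-∑ m (parityC 1ℙ k) m<N ⟩
  -- Past the first k terms, which vanish, this range consists of m + 1 pairs of an even and an odd
  -- distance; m terms remain once i = 0 is split off.
  ∑ (λ j → parityC 1ℙ k j * stirling₁ m j) (k + 2 * suc m)
    ≡⟨ ∑-drop k (λ {j} j<k → cong (_* stirling₁ m j) (parityC-< 1ℙ j<k)) (2 * suc m) ⟩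
  ∑ (λ d → parityC 1ℙ k (k + d) * stirling₁ m (k + d)) (2 * suc m)
    ≡⟨ ∑-odd {λ d → parityC 1ℙ k (k + d) * stirling₁ m (k + d)} (λ i → cong (_* stirling₁ m (k + 2 * i)) (parityC-even k i)) (suc m) ⟩
  ∑ (λ i → parityC 1ℙ k (k + suc (2 * i)) * stirling₁ m (k + suc (2 * i))) (suc m)
    ≡⟨ ∑-cong (λ i → trans (cong (_* stirling₁ m (k + suc (2 * i))) (parityC-odd k i))
                           (cong (λ j → (j C k) * stirling₁ m j) (ℕₚ.+-suc k (2 * i)))) (suc m) ⟩
  ∑ (λ i → ((suc k + 2 * i) C k) * stirling₁ m (suc k + 2 * i)) (suc m)
    ≡⟨ cong (_+ tail) (trans (cong (λ j → (j C k) * stirling₁ m j) (ℕₚ.+-identityʳ (suc k)))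
                             (cong (_* stirling₁ m (suc k)) ([1+n]Cn≡1+n k))) ⟩
  suc k * stirling₁ m (suc k) + tail ∎
  where
  tail = ∑ (λ i → ((suc k + 2 * suc i) C k) * stirling₁ m (suc k + 2 * suc i)) m
  m<N : m < k + 2 * suc m
  m<N = ℕₚ.≤-trans (ℕₚ.m≤m+n (suc m) (1 * suc m)) (ℕₚ.m≤n+m (2 * suc m) k)

-- Passage to ℚ

-- With both denominators 1, the sum unfolds to a normalised fraction over 1, and `↥p/↧p≡p` removes
-- the normalisation.
fromℤ-+ : ∀ i j → fromℤ (i ℤ.+ j) ≡ fromℤ i ℚ.+ fromℤ j
fromℤ-+ i j = trans (sym (ℚₚ.↥p/↧p≡p (fromℤ (i ℤ.+ j))))
  (cong (ℚ._/ 1) (sym (cong₂ ℤ._+_ (ℤₚ.*-identityʳ i) (ℤₚ.*-identityʳ j))))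

fromℤ-* : ∀ i j → fromℤ (i ℤ.* j) ≡ fromℤ i ℚ.* fromℤ j
fromℤ-* i j = sym (ℚₚ.↥p/↧p≡p (fromℤ (i ℤ.* j)))

fromℕ-+ : ∀ m n → fromℕ (m + n) ≡ fromℕ m ℚ.+ fromℕ n
fromℕ-+ m n = fromℤ-+ (+ m) (+ n)

fromℕ-* : ∀ m n → fromℕ (m * n) ≡ fromℕ m ℚ.* fromℕ n
fromℕ-* m n = trans (cong fromℤ (ℤₚ.pos-* m n)) (fromℤ-* (+ m) (+ n))

foldr-∑ : ∀ (a b : ℕ → ℕ) (r : ℚ) n →
          foldr ℚ._+_ 0ℚ (applyUpTo (λ i → fromℕ (a i) ℚ.* (fromℕ (b i) ℚ.* r)) n) ≡
          fromℕ (∑ (λ i → a i * b i) n) ℚ.* r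
foldr-∑ a b r zero    = sym (ℚₚ.*-zeroˡ r)
foldr-∑ a b r (suc n) = begin
  fromℕ (a 0) ℚ.* (fromℕ (b 0) ℚ.* r) ℚ.+ foldr ℚ._+_ 0ℚ (applyUpTo (λ i → fromℕ (a (suc i)) ℚ.* (fromℕ (b (suc i)) ℚ.* r)) n)
    ≡⟨ cong₂ ℚ._+_ (trans (sym (ℚₚ.*-assoc (fromℕ (a 0)) (fromℕ (b 0)) r)) (cong (ℚ._* r) (sym (fromℕ-* (a 0) (b 0)))))
                   (foldr-∑ (a ∘ suc) (b ∘ suc) r n) ⟩
  fromℕ (a 0 * b 0) ℚ.* r ℚ.+ fromℕ s ℚ.* r
    ≡⟨ ℚₚ.*-distribʳ-+ r (fromℕ (a 0 * b 0)) (fromℕ s) ⟨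
  (fromℕ (a 0 * b 0) ℚ.+ fromℕ s) ℚ.* r
    ≡⟨ cong (ℚ._* r) (fromℕ-+ (a 0 * b 0) s) ⟨
  fromℕ (a 0 * b 0 + s) ℚ.* r ∎
  where s = ∑ (λ i → a (suc i) * b (suc i)) n

-- The hypothesis says c (m - k) = s; this is computed in ℤ because `k` may exceed `m`.
÷-diff : ∀ m k c s .{{_ : ℚ.NonZero (diff m k)}} → m * c ≡ k * c + s → fromℕ c ≡ fromℕ s ÷ diff m k
÷-diff m k c s eq = begin
  fromℕ c                                     ≡⟨ ℚₚ.*-identityʳ (fromℕ c) ⟨
  fromℕ c ℚ.* ℚ.1ℚ                            ≡⟨ cong (fromℕ c ℚ.*_) (ℚₚ.*-inverseʳ (diff m k)) ⟨
  fromℕ c ℚ.* (diff m k ℚ.* ℚ.1/ diff m k)    ≡⟨ ℚₚ.*-assoc (fromℕ c) (diff m k) (ℚ.1/ diff m k) ⟨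
  fromℕ c ℚ.* diff m k ÷ diff m k             ≡⟨ cong (_÷ diff m k) (trans (sym (fromℤ-* (+ c) (+ m ℤ.- + k))) (cong fromℤ c*diff)) ⟩
  fromℕ s ÷ diff m k                          ∎
  where
  c*diff : + c ℤ.* (+ m ℤ.- + k) ≡ + s
  c*diff = begin
    + c ℤ.* (+ m ℤ.- + k)                   ≡⟨ ℤₚ.*-comm (+ c) (+ m ℤ.- + k) ⟩
    (+ m ℤ.- + k) ℤ.* + c                   ≡⟨ ℤₚ.*-distribʳ-+ (+ c) (+ m) (ℤ.- + k) ⟩
    + m ℤ.* + c ℤ.+ (ℤ.- + k) ℤ.* + c       ≡⟨ cong₂ ℤ._+_ (trans (sym (ℤₚ.pos-* m c)) (cong +_ eq)) (sym (ℤₚ.neg-distribˡ-* (+ k) (+ c))) ⟩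
    + (k * c) ℤ.+ + s ℤ.- (+ k ℤ.* + c)     ≡⟨ cong (λ z → + (k * c) ℤ.+ + s ℤ.- z) (sym (ℤₚ.pos-* k c)) ⟩
    + (k * c) ℤ.+ + s ℤ.- + (k * c)         ≡⟨ cong (ℤ._- + (k * c)) (ℤₚ.+-comm (+ (k * c)) (+ s)) ⟩
    + s ℤ.+ + (k * c) ℤ.- + (k * c)         ≡⟨ ℤₚ.+-assoc (+ s) (+ (k * c)) (ℤ.- + (k * c)) ⟩
    + s ℤ.+ (+ (k * c) ℤ.- + (k * c))       ≡⟨ cong (ℤ._+_ (+ s)) (ℤₚ.+-inverseʳ (+ (k * c))) ⟩
    + s ℤ.+ + 0                             ≡⟨ ℤₚ.+-identityʳ (+ s) ⟩
    + s                                     ∎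

-- `n + 1` does not reduce to `suc n`, so `m` is a variable with an equation that can be matched
-- against `refl`.
theorem3-suc : ∀ m n k → m ≡ suc n → .{{_ : ℚ.NonZero (diff m (suc k))}} →
  ∃[ S ]
    HasSum₁ (λ i → fromℕ ((suc k + 2 * i) C k)
                     ℚ.* (fromℕ (stirling₁ m (suc k + 2 * i)) ÷ diff m (suc k))) S
    × fromℕ (stirling₁ m (suc k)) ≡
        S ℚ.+ fromℕ (m C 2) ℚ.* (fromℕ (stirling₁ n (suc k)) ÷ diff m (suc k))
-- The bound `m` suffices because k + 1 + 2i exceeds m when i does; it is also the length of the sum
-- in `odd-moment-∑`.
theorem3-suc m n k refl = fromℕ s ℚ.* r , (m , vanish , foldr-∑ (a ∘ suc) (b ∘ suc) r m) , value
  where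
  r = ℚ.1/ diff m (suc k)
  a b : ℕ → ℕ
  a i = (suc k + 2 * i) C k
  b i = stirling₁ m (suc k + 2 * i)
  s = ∑ (λ i → a (suc i) * b (suc i)) m
  t = stirling₁ n (suc k)
  vanish : ∀ i → m < i → fromℕ (a i) ℚ.* (fromℕ (b i) ℚ.* r) ≡ 0ℚ
  vanish i m<i = begin
    fromℕ (a i) ℚ.* (fromℕ (b i) ℚ.* r)
      ≡⟨ cong (λ z → fromℕ (a i) ℚ.* (fromℕ z ℚ.* r)) (stirling₁-vanish (ℕₚ.<-≤-trans m<i
           (ℕₚ.≤-trans (ℕₚ.m≤m+n i (1 * i)) (ℕₚ.m≤n+m (2 * i) (suc k))))) ⟩
    fromℕ (a i) ℚ.* (0ℚ ℚ.* r)  ≡⟨ cong (fromℕ (a i) ℚ.*_) (ℚₚ.*-zeroˡ r) ⟩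
    fromℕ (a i) ℚ.* 0ℚ          ≡⟨ ℚₚ.*-zeroʳ (fromℕ (a i)) ⟩
    0ℚ                          ∎
  value : fromℕ (stirling₁ m (suc k)) ≡ fromℕ s ℚ.* r ℚ.+ fromℕ (m C 2) ℚ.* (fromℕ t ℚ.* r)
  value = begin
    fromℕ (stirling₁ m (suc k))
      ≡⟨ ÷-diff m (suc k) (stirling₁ m (suc k)) (s + (m C 2) * t)
           (trans (odd-moment n k) (trans (cong (_+ (m C 2) * t) (odd-moment-∑ m k)) (ℕₚ.+-assoc (suc k * stirling₁ m (suc k)) s ((m C 2) * t)))) ⟩
    fromℕ (s + (m C 2) * t) ℚ.* r
      ≡⟨ cong (ℚ._* r) (trans (fromℕ-+ s ((m C 2) * t)) (cong (fromℕ s ℚ.+_) (fromℕ-* (m C 2) t))) ⟩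
    (fromℕ s ℚ.+ fromℕ (m C 2) ℚ.* fromℕ t) ℚ.* r
      ≡⟨ ℚₚ.*-distribʳ-+ r (fromℕ s) (fromℕ (m C 2) ℚ.* fromℕ t) ⟩
    fromℕ s ℚ.* r ℚ.+ fromℕ (m C 2) ℚ.* fromℕ t ℚ.* r
      ≡⟨ cong (ℚ._+_ (fromℕ s ℚ.* r)) (ℚₚ.*-assoc (fromℕ (m C 2)) (fromℕ t) r) ⟩
    fromℕ s ℚ.* r ℚ.+ fromℕ (m C 2) ℚ.* (fromℕ t ℚ.* r) ∎

theorem3 : ∀ (n k : ℕ) → 1 ≤ n → 1 ≤ k → (k≢n+1 : k ≢ n + 1) →
    let instance _ = diff-nonZero k≢n+1 in
    ∃[ S ]
    HasSum₁ (λ i → fromℕ ((k + 2 * i) C (k ∸ 1))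
    ℚ.* (fromℕ (stirling₁ (n + 1) (k + 2 * i)) ÷ diff (n + 1) k)) S
    × fromℕ (stirling₁ (n + 1) k) ≡
    S ℚ.+ fromℕ ((n + 1) C 2) ℚ.* (fromℕ (stirling₁ n k) ÷ diff (n + 1) k)
theorem3 n (suc k) _ _ k≢n+1 = theorem3-suc (n + 1) n k (ℕₚ.+-comm n 1) {{diff-nonZero k≢n+1}}
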